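{- Let $G=(V,E)$ and $H=(U,F)$ be finite simple graphs. If $G$ and $H$ are isomorphic, then the uniqueness tree algorithm (described in the context) applied to $G$ and $H$ outputs "$G\cong H$".
   Context: A simple graph is a finite, unweighted, undirected graph with no loops or multiple edges. $G\cong H$ means there is a bijection $f:V\to U$ such that for all $u,v\in V$, $f(u)f(v)\in F$ if and only if $uv\in E$. Let $n$ denote the number of vertices. The uniqueness tree algorithm consists of two stages. Tree generation: for each graph and each vertex $v$ of it, build a rooted tree $T(v)$ whose nodes are labelled by vertices of the graph, level by level. Level $0$ consists of the root, labelled $v$. A node on the current level is unique if its label occurs exactly once among the labels on that level. Each non-unique node becomes a leaf; each unique node labelled $u$ receives one child labelled $w$ for each neighbour $w$ of $u$ in the graph; these children form the next level. This is repeated while some node on the current level is unique and the height of $T(v)$ is less than $n$. Tree comparison: initially no vertex is mapped. For each unmapped $v\in V$ and, in turn, each unmapped $u\in U$, declare $v$ and $u$ equivalent unless one of the following holds: the heights of $T(v)$ and $T(u)$ differ; for some level, the numbers of nodes on that level of $T(v)$ and $T(u)$ differ; for some level and some $i\in\{1,\dots,n-1\}$, the number of nodes on that level having exactly $i$ children differs between $T(v)$ and $T(u)$. If $v$ and $u$ are equivalent, mark both as mapped. At the end, output "$G\cong H$" if all vertices of $V$ and $U$ have been mapped, and "$G\not\cong H$" otherwise. -}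

module Defs where

open import Data.Bool using (Bool; if_then_else_; _∧_; not)
open import Data.List using (List; []; _∷_; map; length; filter; foldl; concatMap; upTo)
open import Data.List.Membership.Propositional using (_∈_)
open import Data.List.Relation.Unary.All using (All; all?)
open import Data.List.Relation.Unary.Any using (any?)
open import Data.List.Relation.Unary.Unique.Propositional using (Unique)
open import Data.Nat using (ℕ; zero; suc; _∸_; _⊔_; _<?_)
import Data.Nat as ℕ
open import Data.Product using (Σ-syntax; _×_; _,_)
open import Function.Bundles using (_⇔_)
open import Function.Definitions using (Bijective)
open import Level using (0ℓ)
open import Relation.Binary using (Rel; Decidable; Symmetric; DecidableEquality)
open import Relation.Binary.PropositionalEquality using (_≡_)
open import Relation.Nullary using (¬_; Dec; does)
open import Relation.Nullary.Decidable using (_×-dec_)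
import Data.List.Membership.DecPropositional as DecMembership

-- The list `vertices` witnesses finiteness.  It also fixes the order in which
-- the algorithm visits the vertices; since it is an arbitrary duplicate-free
-- enumeration, statements about all graphs cover all visiting orders.
record SimpleGraph : Set₁ where
  field
    V        : Set
    _≟_      : DecidableEquality V
    vertices : List V
    complete : ∀ v → v ∈ vertices
    unique   : Unique vertices
    E        : Rel V 0ℓ
    E?       : Decidable E
    E-sym    : Symmetric E
    E-irrefl : ∀ v → ¬ E v v

  order : ℕ
  order = length vertices

  neighbours : V → List V
  neighbours u = filter (E? u) vertices

open SimpleGraph using (V; vertices; order)

_≅_ : SimpleGraph → SimpleGraph → Set
G ≅ H = Σ[ f ∈ (V G → V H) ] (Bijective _≡_ _≡_ f × (∀ u v → SimpleGraph.E H (f u) (f v) ⇔ SimpleGraph.E G u v))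

data Tree (A : Set) : Set where
  node : A → List (Tree A) → Tree A

module _ {A : Set} where

  leaf : A → Tree A
  leaf a = node a []

  label : Tree A → A
  label (node a _) = a

  children : Tree A → List (Tree A)
  children (node _ ts) = ts

  -- The length in edges of a longest path from the root to a leaf.
  height  : Tree A → ℕ
  heights : List (Tree A) → ℕ
  height (node _ ts) = heights ts
  heights []       = 0
  heights (t ∷ ts) = suc (height t) ⊔ heights ts

  -- Each node on level d is represented by the subtree rooted at it.
  level : ℕ → Tree A → List (Tree A)
  level zero    t           = t ∷ []
  level (suc d) (node _ ts) = concatMap (level d) ts

  labels : ℕ → Tree A → List A
  labels d t = map label (level d t)

  attach : ℕ → (A → List A) → Tree A → Tree A
  attach zero    c (node a _)  = node a (map leaf (c a))
  attach (suc d) c (node a ts) = node a (map (attach d c) ts)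

  nodeCount : ℕ → Tree A → ℕ
  nodeCount d t = length (level d t)

  nodeCountWithChildren : ℕ → ℕ → Tree A → ℕ
  nodeCountWithChildren d i t = length (filter (λ s → length (children s) ℕ.≟ i) (level d t))

module TreeGeneration (G : SimpleGraph) where
  open SimpleGraph G hiding (V; vertices; order)

  OccursOnce : List (V G) → V G → Set
  OccursOnce ls u = length (filter (u ≟_) ls) ≡ 1

  occursOnce? : ∀ ls u → Dec (OccursOnce ls u)
  occursOnce? ls u = length (filter (u ≟_) ls) ℕ.≟ 1

  extend : ℕ → Tree (V G) → Tree (V G)
  extend d t = attach d (λ u → if does (occursOnce? (labels d t) u) then neighbours u else []) t

  continue? : ℕ → Tree (V G) → Bool
  continue? d t = does (any? (occursOnce? (labels d t)) (labels d t)) ∧ does (height t <? order G)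

  -- The while loop; d is the current level and the first argument bounds the
  -- number of remaining iterations.
  generate : ℕ → ℕ → Tree (V G) → Tree (V G)
  generate zero    d t = t
  generate (suc k) d t = if continue? d t then generate k (suc d) (extend d t) else t

  -- The bound `order G` never cuts the loop short: after d iterations level d
  -- is either empty or the tree has height d, so continue? (order G) is false.
  T : V G → Tree (V G)
  T v = generate (order G) 0 (leaf v)

open TreeGeneration using (T)

data Output : Set where
  isomorphic nonIsomorphic : Output

-- The last component ranges over i ∈ {1, …, n - 1}.
Equivalent : {A B : Set} → ℕ → Tree A → Tree B → Set
Equivalent n t s =
    height t ≡ height s
  × All (λ d → nodeCount d t ≡ nodeCount d s) (upTo (suc (height t)))
  × All (λ d → All (λ i → nodeCountWithChildren d i t ≡ nodeCountWithChildren d i s) (map suc (upTo (n ∸ 1)))) (upTo (suc (height t)))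

equivalent? : {A B : Set} (n : ℕ) (t : Tree A) (s : Tree B) → Dec (Equivalent n t s)
equivalent? n t s =
        height t ℕ.≟ height s
  ×-dec all? (λ d → nodeCount d t ℕ.≟ nodeCount d s) _
  ×-dec all? (λ d → all? (λ i → nodeCountWithChildren d i t ℕ.≟ nodeCountWithChildren d i s) _) _

module TreeComparison (G H : SimpleGraph) where
  open DecMembership (SimpleGraph._≟_ G) using () renaming (_∈?_ to _∈G?_)
  open DecMembership (SimpleGraph._≟_ H) using () renaming (_∈?_ to _∈H?_)

  -- The vertices of G and of H mapped so far.
  State : Set
  State = List (V G) × List (V H)

  -- When G and H have different orders, the choice of n in `Equivalent` does
  -- not affect the output: vertices are mapped in pairs, so one stays unmapped.
  compare : V G → State → V H → State
  compare v (mG , mH) u =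
    if not (does (v ∈G? mG)) ∧ not (does (u ∈H? mH)) ∧ does (equivalent? (order G) (T G v) (T H u))
    then (v ∷ mG , u ∷ mH)
    else (mG , mH)

  final : State
  final = foldl (λ st v → foldl (compare v) st (vertices H)) ([] , []) (vertices G)

  verdict : State → Output
  verdict (mG , mH) =
    if does (all? (_∈G? mG) (vertices G)) ∧ does (all? (_∈H? mH) (vertices H))
    then isomorphic
    else nonIsomorphic

uniquenessTreeAlgorithm : SimpleGraph → SimpleGraph → Output
uniquenessTreeAlgorithm G H = TreeComparison.verdict G H (TreeComparison.final G H)

{-# OPTIONS --safe #-}

-- An isomorphism f carries T(v) to T(f v) up to reordering children, because
-- uniqueness of a label on a level does not depend on the order of the level;
-- so v and f v are equivalent.  The greedy comparison cannot get stuck: at every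
-- moment some bijection g, with v and g v equivalent for all v, extends the pairs
-- mapped so far.  When v is paired with u ≠ g v, post-composing g with the
-- transposition of g v and u restores this, since any vertex w with g w = u
-- is equivalent to u, hence to v, hence to g v.

module Submission where

open import Data.Bool using (true; false; if_then_else_; not; _∧_)
open import Data.List using (List; []; _∷_; map; length; filter; foldl; concat; concatMap)
open import Data.List.Membership.Propositional using (_∈_; _∉_)
open import Data.List.Membership.Propositional.Properties using (∈-map⁺; ∈-map⁻; ∈-filter⁺; ∈-filter⁻)
open import Data.List.Membership.Propositional.Properties.WithK using (unique∧set⇒bag)
open import Data.List.Properties using (map-cong-local; length-map)
open import Data.List.Relation.Binary.BagAndSetEquality using (∼bag⇒↭)
open import Data.List.Relation.Binary.Permutation.Propositional as ↭ using (_↭_; ↭-refl; ↭-sym; ↭-trans)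
open import Data.List.Relation.Binary.Permutation.Propositional.Properties using (Any-resp-↭; ↭-length; ++⁺; shifts; filter-↭) renaming (map⁺ to ↭-map⁺; ++⁺ˡ to ↭-++⁺ˡ)
open import Data.List.Relation.Binary.Pointwise as Pw using (Pointwise; []; _∷_)
open import Data.List.Relation.Unary.All as All using (All; all?)
open import Data.List.Relation.Unary.Unique.Propositional using (Unique)
open import Data.List.Relation.Unary.Any using (Any; here; there; any?)
import Data.List.Relation.Unary.Unique.Propositional.Properties as Uniq
open import Data.Nat using (zero; suc; _⊔_; _<?_)
open import Data.Nat.Properties using (⊔-commutativeSemigroup)
open import Algebra.Properties.CommutativeSemigroup ⊔-commutativeSemigroup using (x∙yz≈y∙xz)
open import Data.Product using (Σ-syntax; ∃-syntax; _×_; _,_; proj₁; proj₂)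
open import Data.Sum using (_⊎_; inj₁; inj₂)
open import Function using (id; _∘_; _⇔_; mk⇔; Equivalence)
open import Function.Definitions using (Injective; StrictlySurjective)
open import Level using (0ℓ)
open import Relation.Binary using (DecidableEquality; REL)
open import Relation.Binary.PropositionalEquality using (_≡_; _≢_; refl; sym; trans; cong; cong₂; subst)
open import Relation.Nullary using (Dec; yes; no; does; contradiction)
open import Relation.Nullary.Decidable using (does-⇔; dec-true)
open import Relation.Unary using (Pred; Decidable)
open import Defs

open SimpleGraph using (V; vertices; order; neighbours)
open TreeGeneration using (T; occursOnce?; extend; continue?; generate)

private
  variable
    A B C D : Set

-- Permutations and matchings of lists

unique∧set⇒↭ : {xs ys : List A} → Unique xs → Unique ys → (∀ {x} → x ∈ xs ⇔ x ∈ ys) → xs ↭ ys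
unique∧set⇒↭ xs! ys! xs∼ys = ∼bag⇒↭ (unique∧set⇒bag xs! ys! xs∼ys)

concat-↭ : ∀ {xss yss : List (List A)} → xss ↭ yss → concat xss ↭ concat yss
concat-↭ ↭.refl           = ↭-refl
concat-↭ (↭.prep xs p)    = ↭-++⁺ˡ xs (concat-↭ p)
concat-↭ (↭.swap xs ys p) = ↭-trans (shifts xs ys) (↭-++⁺ˡ ys (↭-++⁺ˡ xs (concat-↭ p)))
concat-↭ (↭.trans p q)    = ↭-trans (concat-↭ p) (concat-↭ q)

-- Correspondence of lists as multisets: a graph isomorphism need not respect the order in which the
-- two `vertices` lists, and hence the lists of children, are arranged. One permutation, applied
-- after the `Pointwise` part, is enough.
Matching : REL A B 0ℓ → REL (List A) (List B) 0ℓ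
Matching R xs ys = ∃[ zs ] Pointwise R xs zs × zs ↭ ys

module _ {R : REL A B 0ℓ} where

  length-matching : ∀ {xs ys} → Matching R xs ys → length xs ≡ length ys
  length-matching (_ , xs∼zs , zs↭ys) = trans (Pw.Pointwise-length xs∼zs) (↭-length zs↭ys)

  map-matching : ∀ {S : REL C D 0ℓ} {f : A → C} {g : B → D} →
                 (∀ {a b} → R a b → S (f a) (g b)) →
                 ∀ {xs ys} → Matching R xs ys → Matching S (map f xs) (map g ys)
  map-matching {f = f} {g} R⇒S (_ , xs∼zs , zs↭ys) =
    _ , Pw.map⁺ f g (Pw.map R⇒S xs∼zs) , ↭-map⁺ g zs↭ys

  concat-matching : ∀ {xss yss} → Pointwise (Matching R) xss yss → Matching R (concat xss) (concat yss)
  concat-matching []                             = [] , [] , ↭-refl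
  concat-matching ((_ , xs∼zs , zs↭ys) ∷ ms) with concat-matching ms
  ... | _ , xss∼zss , zss↭yss = _ , Pw.++⁺ xs∼zs xss∼zss , ++⁺ zs↭ys zss↭yss

  concatMap-matching : ∀ {S : REL C D 0ℓ} {f : C → List A} {g : D → List B} →
                       (∀ {c d} → S c d → Matching R (f c) (g d)) →
                       ∀ {xs ys} → Matching S xs ys → Matching R (concatMap f xs) (concatMap g ys)
  concatMap-matching {f = f} {g} S⇒R (_ , xs∼zs , zs↭ys) with concat-matching (Pw.map⁺ f g (Pw.map S⇒R xs∼zs))
  ... | _ , xss∼zss , zss↭yss = _ , xss∼zss , ↭-trans zss↭yss (concat-↭ (↭-map⁺ g zs↭ys))

  module _ {P : Pred A 0ℓ} {Q : Pred B 0ℓ} (P⇔Q : ∀ {a b} → R a b → P a ⇔ Q b) where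

    open Equivalence

    length-filter-matching : (P? : Decidable P) (Q? : Decidable Q) → ∀ {xs ys} →
                             Matching R xs ys → length (filter P? xs) ≡ length (filter Q? ys)
    length-filter-matching P? Q? (_ , xs∼zs , zs↭ys) =
      length-matching (_ , Pw.filter⁺ P? Q? (to ∘ P⇔Q) (from ∘ P⇔Q) xs∼zs , filter-↭ Q? zs↭ys)

    Any-matching : ∀ {xs ys} → Matching R xs ys → Any P xs ⇔ Any Q ys
    Any-matching (_ , xs∼zs , zs↭ys) = mk⇔ (Any-resp-↭ zs↭ys ∘ forth xs∼zs) (back xs∼zs ∘ Any-resp-↭ (↭-sym zs↭ys))
      where
      forth : ∀ {xs ys} → Pointwise R xs ys → Any P xs → Any Q ys
      forth (r ∷ _)  (here p)  = here (to (P⇔Q r) p)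
      forth (_ ∷ rs) (there p) = there (forth rs p)

      back : ∀ {xs ys} → Pointwise R xs ys → Any Q ys → Any P xs
      back (r ∷ _)  (here q)  = here (from (P⇔Q r) q)
      back (_ ∷ rs) (there q) = there (back rs q)

-- Isomorphisms of unordered labelled trees

Graph : (A → B) → REL A B 0ℓ
Graph f a b = f a ≡ b

graph-matching : (f : A → B) {xs : List A} {ys : List B} → map f xs ↭ ys → Matching (Graph f) xs ys
graph-matching f {xs} p = map f xs , pointwise xs , p
  where
  pointwise : ∀ xs → Pointwise (Graph f) xs (map f xs)
  pointwise []       = []
  pointwise (_ ∷ xs) = refl ∷ pointwise xs

data TreeIso (f : A → B) : REL (Tree A) (Tree B) 0ℓ where
  node : ∀ {a b ts ss} → Graph f a b → Matching (TreeIso f) ts ss → TreeIso f (node a ts) (node b ss)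

heights-↭ : ∀ {ts ss : List (Tree A)} → ts ↭ ss → heights ts ≡ heights ss
heights-↭ ↭.refl         = refl
heights-↭ (↭.prep t p)   = cong (suc (height t) ⊔_) (heights-↭ p)
heights-↭ {ss = _ ∷ _ ∷ ss} (↭.swap t s p) =
  trans (cong (λ h → suc (height t) ⊔ (suc (height s) ⊔ h)) (heights-↭ p))
        (x∙yz≈y∙xz (suc (height t)) (suc (height s)) (heights ss))
heights-↭ (↭.trans p q)  = trans (heights-↭ p) (heights-↭ q)

module _ {f : A → B} where

  leaf-iso : ∀ {a b} → Graph f a b → TreeIso f (leaf a) (leaf b)
  leaf-iso fa≡b = node fa≡b ([] , [] , ↭-refl)

  label-iso : ∀ {t s} → TreeIso f t s → Graph f (label t) (label s)
  label-iso (node fa≡b _) = fa≡b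

  children-iso : ∀ {t s} → TreeIso f t s → Matching (TreeIso f) (children t) (children s)
  children-iso (node _ m) = m

  mutual
    height-iso : ∀ {t s} → TreeIso f t s → height t ≡ height s
    height-iso (node _ (_ , ts∼rs , rs↭ss)) = trans (heights-pointwise ts∼rs) (heights-↭ rs↭ss)

    heights-pointwise : ∀ {ts ss} → Pointwise (TreeIso f) ts ss → heights ts ≡ heights ss
    heights-pointwise []       = refl
    heights-pointwise (i ∷ is) = cong₂ (λ m n → suc m ⊔ n) (height-iso i) (heights-pointwise is)

  level-iso : ∀ d {t s} → TreeIso f t s → Matching (TreeIso f) (level d t) (level d s)
  level-iso zero    i          = _ , i ∷ [] , ↭-refl
  level-iso (suc d) (node _ m) = concatMap-matching (level-iso d) m

  labels-iso : ∀ d {t s} → TreeIso f t s → Matching (Graph f) (labels d t) (labels d s)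
  labels-iso d = map-matching label-iso ∘ level-iso d

  attach-iso : ∀ {c : A → List A} {c′ : B → List B} →
               (∀ {a b} → Graph f a b → Matching (Graph f) (c a) (c′ b)) →
               ∀ d {t s} → TreeIso f t s → TreeIso f (attach d c t) (attach d c′ s)
  attach-iso c∼c′ zero    (node fa≡b _) = node fa≡b (map-matching leaf-iso (c∼c′ fa≡b))
  attach-iso c∼c′ (suc d) (node fa≡b m) = node fa≡b (map-matching (attach-iso c∼c′ d) m)

  -- Height and level-wise counts do not see the order of children. The counts agree for every level
  -- and every number of children, so `All.universal` fills the ranges.
  iso⇒equivalent : ∀ n {t s} → TreeIso f t s → Equivalent n t s
  iso⇒equivalent n i =
      height-iso i
    , All.universal (λ d → length-matching (level-iso d i)) _
    , All.universal (λ d → All.universal (λ k → length-filter-matching same-arity _ _ (level-iso d i)) _) _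
    where
    same-arity : ∀ {k t s} → TreeIso f t s → length (children t) ≡ k ⇔ length (children s) ≡ k
    same-arity j = mk⇔ (trans (sym (length-matching (children-iso j)))) (trans (length-matching (children-iso j)))

Equivalent-sym : ∀ n {t : Tree A} {s : Tree B} → Equivalent n t s → Equivalent n s t
-- The range of levels in `Equivalent` is bounded by the height of the first tree; rewriting with
-- `h` makes the two ranges coincide.
Equivalent-sym n (h , c , a) rewrite h = refl , All.map sym c , All.map (All.map sym) a

Equivalent-trans : ∀ n {t : Tree A} {s : Tree B} {r : Tree C} → Equivalent n t s → Equivalent n s r → Equivalent n t r
Equivalent-trans n (h , c , a) (h′ , c′ , a′) rewrite h =
    h′
  , All.zipWith (λ (p , q) → trans p q) (c , c′)
  , All.zipWith (λ (ps , qs) → All.zipWith (λ (p , q) → trans p q) (ps , qs)) (a , a′)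

-- Invariance of tree generation under a graph isomorphism

module GeneratedTrees (G H : SimpleGraph) (iso : G ≅ H) where

  private
    module G = SimpleGraph G
    module H = SimpleGraph H
    f : V G → V H
    f = proj₁ iso

    f-injective : Injective _≡_ _≡_ f
    f-injective = proj₁ (proj₁ (proj₂ iso))

    f-surjective : StrictlySurjective _≡_ f
    f-surjective y = let x , eq = proj₂ (proj₁ (proj₂ iso)) y in x , eq refl

    f-edges : ∀ u v → H.E (f u) (f v) ⇔ G.E u v
    f-edges = proj₂ (proj₂ iso)

  -- The order enters both the guard of the loop and its iteration bound. The image of `vertices G`
  -- under `f` is a duplicate-free list of all vertices of `H`.
  order-iso : order G ≡ order H
  order-iso = trans (sym (length-map f (vertices G)))
    (↭-length (unique∧set⇒↭ (Uniq.map⁺ f-injective G.unique) H.unique (mk⇔ (λ _ → H.complete _) back)))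
    where
    back : ∀ {y} → y ∈ vertices H → y ∈ map f (vertices G)
    back {y} _ with f-surjective y
    ... | x , refl = ∈-map⁺ f (G.complete x)

  neighbours-iso : ∀ {u v} → Graph f u v → Matching (Graph f) (neighbours G u) (neighbours H v)
  neighbours-iso {u} refl = graph-matching f
    (unique∧set⇒↭ (Uniq.map⁺ f-injective (Uniq.filter⁺ (G.E? u) G.unique))
                  (Uniq.filter⁺ (H.E? (f u)) H.unique) (mk⇔ forth back))
    where
    open Equivalence

    forth : ∀ {y} → y ∈ map f (neighbours G u) → y ∈ neighbours H (f u)
    forth y∈ with ∈-map⁻ f y∈
    ... | x , x∈ , refl = ∈-filter⁺ (H.E? (f u)) (H.complete _) (from (f-edges u x) (proj₂ (∈-filter⁻ (G.E? u) {xs = vertices G} x∈)))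

    back : ∀ {y} → y ∈ neighbours H (f u) → y ∈ map f (neighbours G u)
    back {y} y∈ with f-surjective y
    ... | x , refl = ∈-map⁺ f (∈-filter⁺ (G.E? u) (G.complete x) (to (f-edges u x) (proj₂ (∈-filter⁻ (H.E? (f u)) {xs = vertices H} y∈))))

  -- Since `f` is injective, distinct labels stay distinct: `u` occurs in `ls` exactly as often as
  -- `f u` in `ls′`.
  occursOnce-iso : ∀ {ls ls′} → Matching (Graph f) ls ls′ → ∀ {u v} → Graph f u v →
                   TreeGeneration.OccursOnce G ls u ⇔ TreeGeneration.OccursOnce H ls′ v
  occursOnce-iso m {u} refl = mk⇔ (trans (sym count)) (trans count)
    where
    count = length-filter-matching {P = u ≡_} {Q = f u ≡_}
      (λ fa≡b → mk⇔ (λ u≡a → trans (cong f u≡a) fa≡b) (λ fu≡b → f-injective (trans fu≡b (sym fa≡b))))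
      (u G.≟_) (f u H.≟_) m

  extend-iso : ∀ d {t s} → TreeIso f t s → TreeIso f (extend G d t) (extend H d s)
  extend-iso d {t} {s} i = attach-iso children-matching d i
    where
    children-matching : ∀ {u v} → Graph f u v → Matching (Graph f)
      (if does (occursOnce? G (labels d t) u) then neighbours G u else [])
      (if does (occursOnce? H (labels d s) v) then neighbours H v else [])
    -- After the rewrite both conditionals branch on the same Boolean, so one case split settles
    -- both.
    children-matching {u} {v} fu≡v
      rewrite does-⇔ (occursOnce-iso (labels-iso d i) fu≡v) (occursOnce? G (labels d t) u) (occursOnce? H (labels d s) v)
      with does (occursOnce? H (labels d s) v)
    ... | true  = neighbours-iso fu≡v
    ... | false = [] , [] , ↭-refl

  continue-iso : ∀ d {t s} → TreeIso f t s → continue? G d t ≡ continue? H d s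
  continue-iso d {t} {s} i = cong₂ _∧_
    (does-⇔ (Any-matching (occursOnce-iso (labels-iso d i)) (labels-iso d i)) (any? _ _) (any? _ _))
    (cong₂ (λ h n → does (h <? n)) (height-iso i) order-iso)

  -- The two loops run in lockstep: their guards agree as Booleans, and each extension preserves the
  -- isomorphism.
  generate-iso : ∀ k d {t s} → TreeIso f t s → TreeIso f (generate G k d t) (generate H k d s)
  generate-iso zero    d i = i
  generate-iso (suc k) d {t} {s} i rewrite continue-iso d i with continue? H d s
  ... | true  = generate-iso k (suc d) (extend-iso d i)
  ... | false = i

  T-iso : ∀ v → TreeIso f (T G v) (T H (f v))
  T-iso v rewrite order-iso = generate-iso (order H) 0 (leaf-iso refl)

-- The greedy comparison

module Transposition (_≟_ : DecidableEquality A) where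

  transpose : A → A → A → A
  transpose a b x = if does (x ≟ a) then b else if does (x ≟ b) then a else x

  transpose-first : ∀ a b → transpose a b a ≡ b
  transpose-first a b rewrite dec-true (a ≟ a) refl = refl

  transpose-other : ∀ a b {x} → x ≢ a → x ≢ b → transpose a b x ≡ x
  transpose-other a b {x} x≢a x≢b with x ≟ a | x ≟ b
  ... | yes x≡a | _       = contradiction x≡a x≢a
  ... | no _    | yes x≡b = contradiction x≡b x≢b
  ... | no _    | no _    = refl

  transpose-second : ∀ a b → transpose a b b ≡ a
  transpose-second a b with b ≟ a | b ≟ b
  -- If `a` and `b` coincide, the first test already catches `b` and returns `b`.
  ... | yes b≡a | _      = b≡a
  ... | no _    | yes _  = refl
  ... | no _    | no b≢b = contradiction refl b≢b

  transpose-involutive : ∀ a b x → transpose a b (transpose a b x) ≡ x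
  transpose-involutive a b x with x ≟ a | x ≟ b
  ... | yes refl | _        = transpose-second a b
  ... | no _     | yes refl = transpose-first a b
  ... | no x≢a   | no x≢b   = transpose-other a b x≢a x≢b

module GreedyComparison (G H : SimpleGraph) where

  open TreeComparison G H
  open Transposition (SimpleGraph._≟_ H)
  private
    module G = SimpleGraph G
    module H = SimpleGraph H
  open import Data.List.Membership.DecPropositional G._≟_ using () renaming (_∈?_ to _∈G?_)
  open import Data.List.Membership.DecPropositional H._≟_ using () renaming (_∈?_ to _∈H?_)

  _∼_ : REL (V G) (V H) 0ℓ
  v ∼ u = Equivalent (order G) (T G v) (T H u)

  -- Symmetry and transitivity in the form that makes sense between two different vertex sets, as a
  -- zigzag. It serves the vertex that a transposition reroutes.
  ∼-difunctional : ∀ {v v′ u u′} → v ∼ u → v′ ∼ u → v′ ∼ u′ → v ∼ u′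
  ∼-difunctional p q r = Equivalent-trans n p (Equivalent-trans n (Equivalent-sym n q) r)
    where n = order G

  -- The invariant of the comparison. As both lists grow together, `extends` records the pairs
  -- themselves and also that the mapped vertices of `H` are exactly the images of those of `G`.
  record Extension (st : State) : Set where
    field
      g          : V G → V H
      injective  : Injective _≡_ _≡_ g
      surjective : StrictlySurjective _≡_ g
      equivalent : ∀ v → v ∼ g v
      extends    : proj₂ st ≡ map g (proj₁ st)

  open Extension

  extend-pair : ∀ {mG mH v u} → v ∉ mG → u ∉ mH → v ∼ u → Extension (mG , mH) → Extension (v ∷ mG , u ∷ mH)
  extend-pair {mG} {mH} {v} {u} v∉ u∉ v∼u e = record
    { g          = τ ∘ g e
    ; injective  = λ {x} {y} τgx≡τgy → injective e
        (trans (sym (τ-involutive (g e x))) (trans (cong τ τgx≡τgy) (τ-involutive (g e y))))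
    ; surjective = λ y → let x , gx≡τy = surjective e (τ y) in x , trans (cong τ gx≡τy) (τ-involutive y)
    ; equivalent = τg-equivalent
    ; extends    = cong₂ _∷_ (sym (transpose-first (g e v) u))
        (trans (extends e) (map-cong-local (All.tabulate λ x∈ → sym (fixed x∈))))
    }
    where
    τ = transpose (g e v) u
    τ-involutive = transpose-involutive (g e v) u

    τg-equivalent : ∀ x → x ∼ τ (g e x)
    -- The split mirrors the tests in `transpose`: `v` itself now goes to `u`, the vertex formerly
    -- sent to `u` goes to `g e v`, and all others keep their image.
    τg-equivalent x with g e x H.≟ g e v | g e x H.≟ u
    ... | yes gx≡gv | _        = subst (_∼ u) (sym (injective e gx≡gv)) v∼u
    ... | no _      | yes gx≡u = ∼-difunctional (subst (x ∼_) gx≡u (equivalent e x)) v∼u (equivalent e v)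
    ... | no _      | no _     = equivalent e x

    -- Earlier pairs survive: the image of a mapped vertex is not `g e v`, as `v` is unmapped and
    -- `g e` injective, nor `u`, as `u` is unmapped.
    fixed : ∀ {x} → x ∈ mG → τ (g e x) ≡ g e x
    fixed x∈ = transpose-other (g e v) u
      (λ gx≡gv → v∉ (subst (_∈ mG) (injective e gx≡gv) x∈))
      (λ gx≡u → u∉ (subst (u ∈_) (sym (extends e)) (subst (_∈ map (g e) mG) gx≡u (∈-map⁺ (g e) x∈))))

  -- The invariant of the inner loop for `v`, with `us` the candidates still to come; for empty `us`
  -- it says that `v` is mapped. The bijection changes only when `v` gets mapped, so the second
  -- alternative never refers to an outdated one.
  Pending : V G → List (V H) → State → Set
  Pending v us st = Σ[ e ∈ Extension st ] (v ∈ proj₁ st ⊎ g e v ∈ us)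

  -- `compare` with its three tests abstracted: a `with` on the last one fails,
  -- since its `does` unfolds in the goal.
  module _ v u mG mH (v∈? : Dec (v ∈ mG)) (u∈? : Dec (u ∈ mH)) (v∼u? : Dec (v ∼ u)) where

    compareBy : State
    compareBy = if not (does v∈?) ∧ not (does u∈?) ∧ does v∼u? then (v ∷ mG , u ∷ mH) else (mG , mH)

    compareBy-mono : ∀ {x} → x ∈ mG → x ∈ proj₁ compareBy
    compareBy-mono x∈ with not (does v∈?) ∧ not (does u∈?) ∧ does v∼u?
    ... | true  = there x∈
    ... | false = x∈

  -- The critical case is an unmapped `v` meeting `u = g e v`. If `u` were mapped, it would be the
  -- image of a mapped vertex, which injectivity identifies with `v`; and `equivalent` rules out a
  -- failed test.
  compareBy-pending : ∀ v u us mG mH v∈? u∈? v∼u? →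
                      Pending v (u ∷ us) (mG , mH) → Pending v us (compareBy v u mG mH v∈? u∈? v∼u?)
  compareBy-pending v u us mG mH (yes v∈) _ _ (e , _) = e , inj₁ v∈
  compareBy-pending v u us mG mH (no v∉) (no u∉) (yes v∼u) (e , _) = extend-pair v∉ u∉ v∼u e , inj₁ (here refl)
  compareBy-pending v u us mG mH (no v∉) _ _ (e , inj₁ v∈) = contradiction v∈ v∉
  compareBy-pending v u us mG mH (no v∉) (yes u∈) _ (e , inj₂ (there gv∈)) = e , inj₂ gv∈
  compareBy-pending v u us mG mH (no v∉) (yes u∈) _ (e , inj₂ (here refl)) with ∈-map⁻ (g e) (subst (g e v ∈_) (extends e) u∈)
  ... | x , x∈ , gv≡gx = contradiction (subst (_∈ mG) (sym (injective e gv≡gx)) x∈) v∉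
  compareBy-pending v u us mG mH (no v∉) (no u∉) (no v≁u) (e , inj₂ (there gv∈)) = e , inj₂ gv∈
  compareBy-pending v u us mG mH (no v∉) (no u∉) (no v≁u) (e , inj₂ (here refl)) = contradiction (equivalent e v) v≁u

  compare-mono : ∀ v u st {x} → x ∈ proj₁ st → x ∈ proj₁ (compare v st u)
  compare-mono v u (mG , mH) =
    compareBy-mono v u mG mH (v ∈G? mG) (u ∈H? mH) (equivalent? (order G) (T G v) (T H u))

  compare-pending : ∀ v u us st → Pending v (u ∷ us) st → Pending v us (compare v st u)
  compare-pending v u us (mG , mH) =
    compareBy-pending v u us mG mH (v ∈G? mG) (u ∈H? mH) (equivalent? (order G) (T G v) (T H u))

  inner : V G → State → State
  inner v st = foldl (compare v) st (vertices H)

  inner-pending : ∀ v us st → Pending v us st → Pending v [] (foldl (compare v) st us)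
  inner-pending v []       st p = p
  inner-pending v (u ∷ us) st p = inner-pending v us (compare v st u) (compare-pending v u us st p)

  inner-mono : ∀ v us st {x} → x ∈ proj₁ st → x ∈ proj₁ (foldl (compare v) st us)
  inner-mono v []       st = id
  inner-mono v (u ∷ us) st = inner-mono v us (compare v st u) ∘ compare-mono v u st

  -- A vertex mapped in its own round must still be mapped when the verdict is given.
  outer-mono : ∀ vs st {x} → x ∈ proj₁ st → x ∈ proj₁ (foldl (λ s v → inner v s) st vs)
  outer-mono []       st = id
  outer-mono (v ∷ vs) st = outer-mono vs (inner v st) ∘ inner-mono v (vertices H) st

  outer-maps-all : ∀ vs st → Extension st → let st′ = foldl (λ s v → inner v s) st vs in
                   Extension st′ × All (_∈ proj₁ st′) vs
  outer-maps-all []       st e = e , All.[]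
  -- Before the inner loop all of `vertices H` is still to come, including `g e v`; after it no
  -- candidate is left, so only `inj₁` remains.
  outer-maps-all (v ∷ vs) st e with inner-pending v (vertices H) st (e , inj₂ (H.complete (g e v)))
  ... | e′ , inj₁ v∈ with outer-maps-all vs (inner v st) e′
  ...   | e″ , vs∈ = e″ , outer-mono vs (inner v st) v∈ All.∷ vs∈

  verdict-isomorphic : Extension ([] , []) → verdict final ≡ isomorphic
  verdict-isomorphic e₀ with outer-maps-all (vertices G) ([] , []) e₀
  ... | e , vs∈ = cong (if_then isomorphic else nonIsomorphic)
    (cong₂ _∧_ (dec-true (all? (_∈G? proj₁ final) (vertices G)) vs∈)
               (dec-true (all? (_∈H? proj₂ final) (vertices H)) (All.universal mapped _)))
    where
    mapped : ∀ y → y ∈ proj₂ final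
    -- On the side of `H`, surjectivity yields a preimage, which is mapped, and `extends` carries
    -- this over.
    mapped y with surjective e y
    ... | x , refl = subst (g e x ∈_) (sym (extends e)) (∈-map⁺ (g e) (All.lookup vs∈ (G.complete x)))

theorem2 : (G H : SimpleGraph) → G ≅ H → uniquenessTreeAlgorithm G H ≡ isomorphic
theorem2 G H iso@(f , (f-injective , f-surjective) , _) = verdict-isomorphic record
  -- Nothing is mapped at the start, so the isomorphism itself is the first bijection.
  { g          = f
  ; injective  = f-injective
  ; surjective = λ y → let x , eq = f-surjective y in x , eq refl
  ; equivalent = λ v → iso⇒equivalent (order G) (T-iso v)
  ; extends    = refl
  }
  where
  open GeneratedTrees G H iso
  open GreedyComparison G H
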